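{- For every positive integer $r$ there is $n_0$ such that for all $n\ge n_0$, every $r$-degenerate bipartite graph $H$ with $n$ vertices satisfies $r(H)\le 2^{8r^{1/3}(\log_2 n)^{2/3}}n$.
   Context: A graph is $r$-degenerate if every one of its subgraphs contains a vertex of degree at most $r$. For a graph $H$, the Ramsey number $r(H)$ is the minimum positive integer $N$ such that every $2$-coloring of the edges of $K_N$ contains a monochromatic copy of $H$. Logarithms are base $2$. -}

module Defs where

open import Data.Nat using (ℕ; zero; suc; _+_; _*_; _^_; _≤_; _<_)
open import Data.Bool using (Bool; true; false; if_then_else_)
open import Data.Fin using (Fin)
open import Data.List using (List; map)
open import Data.Nat.ListAction using (sum)
open import Data.List.Base using (allFin)
open import Data.Product using (Σ; ∃; ∃-syntax; _×_; _,_)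
open import Relation.Binary.PropositionalEquality using (_≡_; _≢_)
open import Function.Definitions using (Injective)

record Graph (n : ℕ) : Set where
  field
    Adj    : Fin n → Fin n → Bool
    sym    : ∀ u v → Adj u v ≡ Adj v u
    irrefl : ∀ u → Adj u u ≡ false
open Graph public

count : (n : ℕ) → (Fin n → Bool) → ℕ
count n f = sum (map (λ i → if f i then 1 else 0) (allFin n))

record Subgraph {n : ℕ} (H : Graph n) : Set where
  field
    verts    : Fin n → Bool
    edges    : Fin n → Fin n → Bool
    esym     : ∀ u v → edges u v ≡ edges v u
    e⊆Adj    : ∀ u v → edges u v ≡ true → Adj H u v ≡ true
    e⊆verts  : ∀ u v → edges u v ≡ true → verts u ≡ true × verts v ≡ true
open Subgraph public

degIn : {n : ℕ} {H : Graph n} → Subgraph H → Fin n → ℕ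
degIn {n} S u = count n (edges S u)

Degenerate : ℕ → {n : ℕ} → Graph n → Set
Degenerate r {n} H =
  (S : Subgraph H) → (∃[ u ] verts S u ≡ true) →
  ∃[ u ] (verts S u ≡ true × degIn S u ≤ r)

Bipartite : {n : ℕ} → Graph n → Set
Bipartite {n} H =
  Σ (Fin n → Bool) λ χ → ∀ u v → Adj H u v ≡ true → χ u ≢ χ v

-- A red/blue colouring of the edges of K_N (value on the diagonal unused).
EdgeColouring : ℕ → Set
EdgeColouring N = Σ (Fin N → Fin N → Bool) λ c → ∀ i j → c i j ≡ c j i

MonoCopy : {n : ℕ} → Graph n → {N : ℕ} → EdgeColouring N → Set
MonoCopy {n} H {N} (c , _) =
  Σ Bool λ b → Σ (Fin n → Fin N) λ f →
    Injective _≡_ _≡_ f × (∀ u v → Adj H u v ≡ true → c (f u) (f v) ≡ b)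

RamseyProp : {n : ℕ} → Graph n → ℕ → Set
RamseyProp H N = (c : EdgeColouring N) → MonoCopy H c

IsRamseyNumber : {n : ℕ} → Graph n → ℕ → Set
IsRamseyNumber H N =
  1 ≤ N × RamseyProp H N × (∀ M → 1 ≤ M → RamseyProp H M → N ≤ M)

-- RamseyBound r n N  encodes the real inequality
--     N ≤ 2^(8 r^(1/3) (log₂ n)^(2/3)) · n
-- without real numbers.  Writing u = log₂(N/n), L = log₂ n, it says
--   for every rational p/q < u  (i.e. n^q·2^p < N^q)  we have (p/q)^3 < 512 r L^2,
-- and (p/q)^3 < 512 r L^2 is witnessed by a rational s/t with
--   s/t < L  (i.e. 2^s < n^t)  and  p^3 t^2 < 512 r q^3 s^2.
-- For n ≥ 1 this is equivalent to the real inequality.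
RamseyBound : ℕ → ℕ → ℕ → Set
RamseyBound r n N =
  ∀ p q → 1 ≤ q → n ^ q * 2 ^ p < N ^ q →
    ∃[ s ] ∃[ t ] (1 ≤ t × 2 ^ s < n ^ t ×
      p ^ 3 * t ^ 2 < 512 * r * q ^ 3 * s ^ 2)

{-# OPTIONS --safe #-}
-- Dependent random choice, applied twice.  Let 2^ℓ < n ≤ 2^(ℓ+1), let k be the
-- integer cube root of 8rℓ² and w the least integer above 2rℓ/k, and colour K_M with
-- M = n 2^(4k); let E be a colour with ∑ deg^k ≥ M (M/2)^k / 2.  For some k-tuple T,
-- the common E-neighbourhood U₁ of T has at least M / 2^(k+2) vertices, and every
-- (r + w)-tuple in U₁ has at least n common neighbours.  For some w-tuple W in U₁,
-- with common neighbourhood U₂, every r-tuple in U₂ has n common neighbours in U₁; an r-tuple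
-- in U₁ has n common neighbours in U₂ because its concatenation with W is an
-- (r + w)-tuple in U₁.  Then H embeds greedily along a degeneracy order, one part
-- into each Uᵢ.  Since log₂ (M / n) = 4k and (4k)³ ≤ 512 r ℓ², M satisfies the bound.
-- Ramsey numbers exist constructively because finitely many colourings and maps
-- have to be searched.
module Submission where

open import Defs hiding (sym)
open import Data.Bool using (Bool; true; false; not; _∧_; _∨_; if_then_else_)
open import Data.Bool.ListAction using (all)
open import Data.Bool.Properties as Bool using (∧-assoc; ∧-comm; ∧-identityʳ; ∨-comm; ∨-idem)
open import Data.Empty using (⊥-elim)
open import Data.Fin using (Fin)
import Data.Fin as Fin
import Data.Fin.Properties as Fin
open import Data.List using (List; []; _∷_; _++_; map; length; allFin; cartesianProductWith; replicate; filterᵇ)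
open import Data.List.Membership.Propositional using (_∈_)
open import Data.List.Membership.Propositional.Properties using (∈-allFin; ∈-cartesianProductWith⁺; ∈-cartesianProductWith⁻)
open import Data.List.Properties using (map-cong; map-∘; map-++; length-map; length-++; length-tabulate; length-replicate)
open import Data.List.Relation.Unary.All using (All; []; _∷_)
open import Data.List.Relation.Unary.AllPairs using ([]; _∷_)
open import Data.List.Relation.Unary.Any using (here; there)
open import Data.List.Relation.Unary.Unique.Propositional using (Unique)
open import Data.List.Relation.Unary.Unique.Propositional.Properties using (allFin⁺)
open import Data.Nat using (ℕ; zero; suc; _+_; _*_; _^_; _∸_; _≤_; _<_; _≤?_; _<?_; _≤ᵇ_; z≤n; s≤s; s≤s⁻¹; z<s; NonZero; >-nonZero; _/_; _%_)
open import Data.Nat.DivMod using (m≡m%n+[m/n]*n; m%n<n; m/n*n≤m)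
open import Data.Nat.ListAction using (sum)
open import Data.Nat.ListAction.Properties using (sum-++)
open import Data.Nat.Properties
open import Data.Nat.Tactic.RingSolver using (solve-∀)
open import Data.Product using (Σ; ∃; ∃-syntax; _×_; _,_; proj₁; proj₂)
open import Data.Sum using (_⊎_; inj₁; inj₂)
open import Data.Vec using (Vec; []; _∷_)
import Data.Vec as Vec
import Data.Vec.Properties as Vec
open import Function using (_∘_; flip; id)
open import Function.Definitions using (Injective)
open import Relation.Binary.PropositionalEquality using (_≡_; _≢_; refl; sym; trans; cong; cong₂; subst; module ≡-Reasoning)
open import Relation.Nullary using (¬_; Dec; does; yes; no; contradiction)
open import Relation.Nullary.Decidable using (map′; ¬?; _×-dec_; _→-dec_; decidable-stable; dec-true; dec-false)
open import Relation.Unary using (Decidable)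

private variable
  A B : Set

-- Finite sums and counts over lists.

∑ : List A → (A → ℕ) → ℕ
∑ xs f = sum (map f xs)

⟦_⟧ : Bool → ℕ
⟦ b ⟧ = if b then 1 else 0

cnt : List A → (A → Bool) → ℕ
cnt xs p = ∑ xs (λ x → ⟦ p x ⟧)

∑-cong : (xs : List A) {f g : A → ℕ} → (∀ x → f x ≡ g x) → ∑ xs f ≡ ∑ xs g
∑-cong xs eq = cong sum (map-cong eq xs)

∑-mono : (xs : List A) {f g : A → ℕ} → (∀ x → f x ≤ g x) → ∑ xs f ≤ ∑ xs g
∑-mono []       le = z≤n
∑-mono (x ∷ xs) le = +-mono-≤ (le x) (∑-mono xs le)

∑-++ : (xs ys : List A) (f : A → ℕ) → ∑ (xs ++ ys) f ≡ ∑ xs f + ∑ ys f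
∑-++ xs ys f = trans (cong sum (map-++ f xs ys)) (sum-++ (map f xs) (map f ys))

∑-+ : (xs : List A) (f g : A → ℕ) → ∑ xs (λ x → f x + g x) ≡ ∑ xs f + ∑ xs g
∑-+ []       f g = refl
∑-+ (x ∷ xs) f g rewrite ∑-+ xs f g = interchange (f x) (g x) (∑ xs f) (∑ xs g)
  where
  interchange : ∀ a b c d → a + b + (c + d) ≡ a + c + (b + d)
  interchange = solve-∀

∑-*ˡ : (xs : List A) (c : ℕ) (f : A → ℕ) → ∑ xs (λ x → c * f x) ≡ c * ∑ xs f
∑-*ˡ []       c f = sym (*-zeroʳ c)
∑-*ˡ (x ∷ xs) c f rewrite ∑-*ˡ xs c f = sym (*-distribˡ-+ c (f x) (∑ xs f))

∑-*ʳ : (xs : List A) (f : A → ℕ) (c : ℕ) → ∑ xs (λ x → f x * c) ≡ ∑ xs f * c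
∑-*ʳ xs f c = trans (∑-cong xs (λ x → *-comm (f x) c)) (trans (∑-*ˡ xs c f) (*-comm c (∑ xs f)))

∑-const : (xs : List A) (c : ℕ) → ∑ xs (λ _ → c) ≡ length xs * c
∑-const []       c = refl
∑-const (x ∷ xs) c = cong (c +_) (∑-const xs c)

∑-swap : (xs : List A) (ys : List B) (f : A → B → ℕ) →
         ∑ xs (λ x → ∑ ys (f x)) ≡ ∑ ys (λ y → ∑ xs (λ x → f x y))
∑-swap []       ys f = sym (trans (∑-const ys 0) (*-zeroʳ (length ys)))
∑-swap (x ∷ xs) ys f rewrite ∑-swap xs ys f = sym (∑-+ ys (f x) (λ y → ∑ xs (λ x → f x y)))

∈⇒≤∑ : {xs : List A} {x : A} (f : A → ℕ) → x ∈ xs → f x ≤ ∑ xs f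
∈⇒≤∑ f (here refl)         = m≤m+n _ _
∈⇒≤∑ f (there {x = y} x∈) = m≤n⇒m≤o+n (f y) (∈⇒≤∑ f x∈)

-- The first-moment method without probabilities: sums over the sample space stand in for
-- expectations, and since `_<?_` is decidable a good outcome is found by scanning the list.
∑-<⇒∃< : (xs : List A) (f g : A → ℕ) → ∑ xs f < ∑ xs g → ∃[ x ] (x ∈ xs × f x < g x)
∑-<⇒∃< (x ∷ xs) f g lt with f x <? g x
... | yes fx<gx = x , here refl , fx<gx
... | no  fx≮gx with ∑ xs f <? ∑ xs g
...   | yes lt′ = let y , y∈ , fy<gy = ∑-<⇒∃< xs f g lt′ in y , there y∈ , fy<gy
...   | no  ≮   = contradiction lt (≤⇒≯ (+-mono-≤ (≮⇒≥ fx≮gx) (≮⇒≥ ≮)))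

⟦⟧≤1 : ∀ b → ⟦ b ⟧ ≤ 1
⟦⟧≤1 true  = ≤-refl
⟦⟧≤1 false = z≤n

⟦∧⟧ : ∀ a b → ⟦ a ∧ b ⟧ ≡ ⟦ a ⟧ * ⟦ b ⟧
⟦∧⟧ true  b = sym (+-identityʳ ⟦ b ⟧)
⟦∧⟧ false b = refl

0<⟦⟧⇒true : ∀ b → 0 < ⟦ b ⟧ → b ≡ true
0<⟦⟧⇒true true _ = refl

cnt-cong : (xs : List A) {p q : A → Bool} → (∀ x → p x ≡ q x) → cnt xs p ≡ cnt xs q
cnt-cong xs eq = ∑-cong xs (cong ⟦_⟧ ∘ eq)

cnt≤length : (xs : List A) (p : A → Bool) → cnt xs p ≤ length xs
cnt≤length xs p = ≤-trans (∑-mono xs (⟦⟧≤1 ∘ p)) (≤-reflexive (trans (∑-const xs 1) (*-identityʳ _)))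

0<cnt⇒∃ : (xs : List A) (p : A → Bool) → 0 < cnt xs p → ∃[ x ] p x ≡ true
0<cnt⇒∃ xs p pos =
  let x , _ , 0<px = ∑-<⇒∃< xs (λ _ → 0) (λ x → ⟦ p x ⟧)
                       (subst (_< cnt xs p) (sym (trans (∑-const xs 0) (*-zeroʳ (length xs)))) pos)
  in x , 0<⟦⟧⇒true (p x) 0<px

-- Boolean universal quantification over lists.

∧-true : ∀ {a b} → a ∧ b ≡ true → a ≡ true × b ≡ true
∧-true {true} {true} _ = refl , refl

all-++ : (p : A → Bool) (xs ys : List A) → all p (xs ++ ys) ≡ all p xs ∧ all p ys
all-++ p []       ys = refl
all-++ p (x ∷ xs) ys rewrite all-++ p xs ys = sym (∧-assoc (p x) (all p xs) (all p ys))

all-∧ : (p q : A → Bool) (xs : List A) → all (λ x → p x ∧ q x) xs ≡ all p xs ∧ all q xs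
all-∧ p q []       = refl
all-∧ p q (x ∷ xs) rewrite all-∧ p q xs with p x | q x
... | false | _     = refl
... | true  | true  = refl
... | true  | false = sym (Bool.∧-zeroʳ (all p xs))

all-true : (xs : List A) → all (λ _ → true) xs ≡ true
all-true []       = refl
all-true (x ∷ xs) = all-true xs

all-swap : (R : A → B → Bool) (xs : List A) (ys : List B) →
           all (λ x → all (R x) ys) xs ≡ all (λ y → all (flip R y) xs) ys
all-swap R []       ys = sym (all-true ys)
all-swap R (x ∷ xs) ys rewrite all-swap R xs ys = sym (all-∧ (R x) (λ y → all (flip R y) xs) ys)

all-cong : {p q : A → Bool} (xs : List A) → (∀ x → p x ≡ q x) → all p xs ≡ all q xs
all-cong []       eq = refl
all-cong (x ∷ xs) eq = cong₂ _∧_ (eq x) (all-cong xs eq)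

all-∈ : {p : A → Bool} {x : A} {xs : List A} → all p xs ≡ true → x ∈ xs → p x ≡ true
all-∈ {p = p} h (here refl) = proj₁ (∧-true h)
all-∈ {p = p} h (there {x = y} x∈) = all-∈ (proj₂ (∧-true {p y} h)) x∈

^-distribʳ-* : ∀ k m n → (m * n) ^ k ≡ m ^ k * n ^ k
^-distribʳ-* zero    m n = refl
^-distribʳ-* (suc k) m n rewrite ^-distribʳ-* k m n = interchange m n (m ^ k) (n ^ k)
  where
  interchange : ∀ a b c d → a * b * (c * d) ≡ a * c * (b * d)
  interchange = solve-∀

-- Tuples and their counts.

tuples : List A → ℕ → List (List A)
tuples xs zero    = [] ∷ []
tuples xs (suc k) = cartesianProductWith _∷_ xs (tuples xs k)

length-cartesianProductWith : {C : Set} (c : A → B → C) (xs : List A) (ys : List B) →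
  length (cartesianProductWith c xs ys) ≡ length xs * length ys
length-cartesianProductWith c []       ys = refl
length-cartesianProductWith c (x ∷ xs) ys =
  trans (length-++ (map (c x) ys))
        (cong₂ _+_ (length-map (c x) ys) (length-cartesianProductWith c xs ys))

length-tuples : (xs : List A) (k : ℕ) → length (tuples xs k) ≡ length xs ^ k
length-tuples xs zero    = refl
length-tuples xs (suc k) = trans (length-cartesianProductWith _∷_ xs (tuples xs k))
                                 (cong (length xs *_) (length-tuples xs k))

∈-tuples : (xs : List A) → (∀ x → x ∈ xs) → (T : List A) → T ∈ tuples xs (length T)
∈-tuples xs full []      = here refl
∈-tuples xs full (t ∷ T) = ∈-cartesianProductWith⁺ _∷_ (full t) (∈-tuples xs full T)

∑-cartesianProductWith : {C : Set} (c : A → B → C) (xs : List A) (ys : List B) (f : C → ℕ) →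
  ∑ (cartesianProductWith c xs ys) f ≡ ∑ xs (λ x → ∑ ys (λ y → f (c x y)))
∑-cartesianProductWith c []       ys f = refl
∑-cartesianProductWith c (x ∷ xs) ys f =
  trans (∑-++ (map (c x) ys) _ f)
        (cong₂ _+_ (cong sum (sym (map-∘ ys))) (∑-cartesianProductWith c xs ys f))

-- The entries are chosen independently, so counts multiply. Summed over vertices, this turns the
-- total size of the common neighbourhoods of `k`-tuples into the `k`-th degree moment.
cnt-tuples : (xs : List A) (p : A → Bool) (k : ℕ) → cnt (tuples xs k) (all p) ≡ cnt xs p ^ k
cnt-tuples xs p zero    = refl
cnt-tuples xs p (suc k) = begin
  cnt (tuples xs (suc k)) (all p)
    ≡⟨ ∑-cartesianProductWith _∷_ xs (tuples xs k) _ ⟩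
  ∑ xs (λ x → ∑ (tuples xs k) (λ T → ⟦ p x ∧ all p T ⟧))
    ≡⟨ ∑-cong xs (λ x → trans (∑-cong (tuples xs k) (λ T → ⟦∧⟧ (p x) (all p T)))
                              (∑-*ˡ (tuples xs k) ⟦ p x ⟧ _)) ⟩
  ∑ xs (λ x → ⟦ p x ⟧ * cnt (tuples xs k) (all p))
    ≡⟨ ∑-*ʳ xs _ _ ⟩
  cnt xs p * cnt (tuples xs k) (all p)
    ≡⟨ cong (cnt xs p *_) (cnt-tuples xs p k) ⟩
  cnt xs p * cnt xs p ^ k ∎
  where open ≡-Reasoning

∈-tuples⇒length : (xs : List A) (k : ℕ) {T : List A} → T ∈ tuples xs k → length T ≡ k
∈-tuples⇒length xs zero    (here refl) = refl
∈-tuples⇒length xs (suc k) T∈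
  with _ , T′ , _ , T′∈ , refl ← ∈-cartesianProductWith⁻ _∷_ xs (tuples xs k) T∈
  = cong suc (∈-tuples⇒length xs k T′∈)

-- Dependent random choice and rich pairs.

≤ᵇ-false : ∀ {m n} → m < n → (n ≤ᵇ m) ≡ false
≤ᵇ-false {m} {n} m<n = dec-false (n ≤? m) (<⇒≱ m<n)

≤ᵇ-true : ∀ {m n} → m ≤ n → (m ≤ᵇ n) ≡ true
≤ᵇ-true {m} {n} = dec-true (m ≤? n)

-- Dependent random choice: a "bad" y, having fewer than n elements of xs, lies
-- over at most n ^ k of the k-tuples, so bad y's are rare on average over T.
dependent-random-choice :
  (xs : List A) (ys : List B) (R : B → A → Bool) (k n h C : ℕ) (g : List A → ℕ) →
  (∀ T → g T ≤ C) →
  h * length xs ^ k + C * (length ys * n ^ k) < ∑ (tuples xs k) g →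
  ∃[ T ] (T ∈ tuples xs k × h < g T ×
          (∀ {y} → y ∈ ys → all (R y) T ≡ true → n ≤ cnt xs (R y)))
dependent-random-choice xs ys R k n h C g g≤C large =
  -- `C` is a penalty for each bad `y` lying over `T`. As `g T ≤ C`, a single one would refute
  -- `h + C * weight T < g T`, so this inequality yields both `h < g T` and the absence of bad
  -- elements over `T`.
  let T , T∈ , lt = ∑-<⇒∃< (tuples xs k) (λ T → h + C * weight T) g (≤-<-trans total large)
  in T , T∈ , ≤-<-trans (m≤m+n h _) lt , good T lt
  where
  bad : _ → Bool
  bad y = not (n ≤ᵇ cnt xs (R y))

  weight : List _ → ℕ
  weight T = ∑ ys (λ y → ⟦ bad y ⟧ * ⟦ all (R y) T ⟧)

  bad-bound : ∀ y → ⟦ bad y ⟧ * cnt xs (R y) ^ k ≤ n ^ k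
  bad-bound y with n ≤? cnt xs (R y)
  ... | yes n≤ rewrite ≤ᵇ-true n≤ = z≤n
  ... | no  n≰ = ≤-trans (*-mono-≤ (⟦⟧≤1 (bad y)) (^-monoˡ-≤ k (<⇒≤ (≰⇒> n≰)))) (≤-reflexive (+-identityʳ _))

  total : ∑ (tuples xs k) (λ T → h + C * weight T) ≤ h * length xs ^ k + C * (length ys * n ^ k)
  total = begin
    ∑ Ts (λ T → h + C * weight T)
      ≡⟨ ∑-+ Ts _ _ ⟩
    ∑ Ts (λ _ → h) + ∑ Ts (λ T → C * weight T)
      ≡⟨ cong₂ _+_ (trans (∑-const Ts h) (trans (*-comm _ h) (cong (h *_) (length-tuples xs k))))
                   (∑-*ˡ Ts C weight) ⟩
    h * length xs ^ k + C * ∑ Ts weight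
      ≡⟨ cong (λ z → h * length xs ^ k + C * z) (∑-swap Ts ys _) ⟩
    h * length xs ^ k + C * ∑ ys (λ y → ∑ Ts (λ T → ⟦ bad y ⟧ * ⟦ all (R y) T ⟧))
      ≡⟨ cong (λ z → h * length xs ^ k + C * z)
              (∑-cong ys (λ y → trans (∑-*ˡ Ts ⟦ bad y ⟧ _) (cong (⟦ bad y ⟧ *_) (cnt-tuples xs (R y) k)))) ⟩
    h * length xs ^ k + C * ∑ ys (λ y → ⟦ bad y ⟧ * cnt xs (R y) ^ k)
      ≤⟨ +-monoʳ-≤ (h * length xs ^ k) (*-monoʳ-≤ C (∑-mono ys bad-bound)) ⟩
    h * length xs ^ k + C * ∑ ys (λ _ → n ^ k)
      ≡⟨ cong (λ z → h * length xs ^ k + C * z) (∑-const ys (n ^ k)) ⟩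
    h * length xs ^ k + C * (length ys * n ^ k) ∎
    where
    open ≤-Reasoning
    Ts = tuples xs k

  good : ∀ T → h + C * weight T < g T → ∀ {y} → y ∈ ys → all (R y) T ≡ true → n ≤ cnt xs (R y)
  good T lt {y} y∈ Ry with n ≤? cnt xs (R y)
  ... | yes n≤ = n≤
  ... | no  n≰ = contradiction (<-≤-trans lt (g≤C T)) (≤⇒≯ C≤)
    where
    1≤weight : 1 ≤ weight T
    1≤weight = subst (_≤ weight T)
      (cong₂ (λ b c → ⟦ not b ⟧ * ⟦ c ⟧) (≤ᵇ-false (≰⇒> n≰)) Ry)
      (∈⇒≤∑ (λ y → ⟦ bad y ⟧ * ⟦ all (R y) T ⟧) y∈)

    C≤ : C ≤ h + C * weight T
    C≤ = ≤-trans (≤-trans (≤-reflexive (sym (*-identityʳ C))) (*-monoʳ-≤ C 1≤weight)) (m≤n+m _ h)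

-- Tuples have length exactly `r` and may repeat entries, which matches the counting by `tuples`;
-- `Rich-≤` recovers shorter ones.
Rich : {M : ℕ} → (Fin M → Fin M → Bool) → ℕ → ℕ → (Fin M → Bool) → (Fin M → Bool) → Set
Rich {M} E r n U W =
  ∀ R → length R ≡ r → all U R ≡ true → n ≤ cnt (allFin M) (λ x → W x ∧ all (E x) R)

module _ {M : ℕ} (E : Fin M → Fin M → Bool) (E-sym : ∀ x y → E x y ≡ E y x) where

  private
    V = allFin M

    ∣V∣ : length V ≡ M
    ∣V∣ = length-tabulate id

    ∈V^ : ∀ {k} T → length T ≡ k → T ∈ tuples V k
    ∈V^ T refl = ∈-tuples V ∈-allFin T

    -- Both sides say that `S` and `T` are completely joined. Dependent random choice tests the
    -- sample against the neighbourhood of a tuple, whereas richness tests the tuple against the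
    -- neighbourhood of the sample.
    all-E-swap : ∀ S T → all (λ x → all (E x) S) T ≡ all (λ x → all (E x) T) S
    all-E-swap S T = trans (all-swap E T S)
                           (all-cong S (λ y → all-cong T (λ x → E-sym x y)))

  -- The sample `T` is weighted by the size of its common neighbourhood, and the total weight is the
  -- degree moment in `dense`. The factor `2 ^ (2 + k)` avoids division, making the threshold simply
  -- `M`. By `few`, bad `q`-tuples contribute little.
  large-common-neighbourhood : (k q n : ℕ) →
    M ^ suc k ≤ 2 ^ suc k * ∑ V (λ v → cnt V (E v) ^ k) →
    1 ≤ M →
    2 ^ (2 + k) * (M ^ q * n ^ k) < M ^ k →
    ∃[ T ] (M < 2 ^ (2 + k) * cnt V (λ v → all (E v) T) ×
            (∀ Q → length Q ≡ q → all (λ v → all (E v) T) Q ≡ true → n ≤ cnt V (λ v → all (E v) Q)))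
  large-common-neighbourhood k q n dense 1≤M few =
    let T , _ , big , good = dependent-random-choice V (tuples V q) (λ Q v → all (E v) Q) k n M C
                               (λ T → 2 ^ (2 + k) * N T) N-bound enough
    in T , big , λ Q ∣Q∣ hQ → good (∈V^ Q ∣Q∣) (trans (all-E-swap Q T) hQ)
    where
    N : List (Fin M) → ℕ
    N T = cnt V (λ v → all (E v) T)

    C = 2 ^ (2 + k) * M

    N-bound : ∀ T → 2 ^ (2 + k) * N T ≤ C
    N-bound T = *-monoʳ-≤ (2 ^ (2 + k)) (≤-trans (cnt≤length V _) (≤-reflexive ∣V∣))

    ∑N : ∑ (tuples V k) N ≡ ∑ V (λ v → cnt V (E v) ^ k)
    ∑N = trans (∑-swap (tuples V k) V _) (∑-cong V (λ v → cnt-tuples V (E v) k))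

    rearrange : ∀ a m b c → m * c + a * m * b ≡ m * (c + a * b)
    rearrange = solve-∀

    twice : ∀ m c → m * (c + c) ≡ 2 * (m * c)
    twice = solve-∀

    -- The moment bound supplies `2 * M ^ suc k`. One half pays for the threshold `M` over all
    -- `M ^ k` samples; by `few`, the other exceeds the total penalty.
    enough : M * length V ^ k + C * (length (tuples V q) * n ^ k) < ∑ (tuples V k) (λ T → 2 ^ (2 + k) * N T)
    enough rewrite length-tuples V q | ∣V∣ = begin-strict
      M * M ^ k + C * (M ^ q * n ^ k)
        ≡⟨ rearrange (2 ^ (2 + k)) M (M ^ q * n ^ k) (M ^ k) ⟩
      M * (M ^ k + 2 ^ (2 + k) * (M ^ q * n ^ k))
        <⟨ *-monoʳ-< M {{>-nonZero 1≤M}} (+-monoʳ-< (M ^ k) few) ⟩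
      M * (M ^ k + M ^ k)
        ≡⟨ twice M (M ^ k) ⟩
      2 * M ^ suc k
        ≤⟨ *-monoʳ-≤ 2 dense ⟩
      2 * (2 ^ suc k * ∑ V (λ v → cnt V (E v) ^ k))
        ≡⟨ *-assoc 2 (2 ^ suc k) _ ⟨
      2 ^ (2 + k) * ∑ V (λ v → cnt V (E v) ^ k)
        ≡⟨ cong (2 ^ (2 + k) *_) ∑N ⟨
      2 ^ (2 + k) * ∑ (tuples V k) N
        ≡⟨ ∑-*ˡ (tuples V k) (2 ^ (2 + k)) N ⟨
      ∑ (tuples V k) (λ T → 2 ^ (2 + k) * N T) ∎
      where open ≤-Reasoning

  -- The sample is drawn from all of `V`, but its weight is the indicator of lying inside `U`; hence
  -- `h = 0` and `C = 1`. The number `1 / a` is a lower bound for the density of `U`.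
  rich-pair : (r w n a : ℕ) (U : Fin M → Bool) →
    M < a * cnt V U →
    a ^ w * (M ^ r * n ^ w) < M ^ w →
    (∀ Q → length Q ≡ r + w → all U Q ≡ true → n ≤ cnt V (λ v → all (E v) Q)) →
    ∃[ W ] (Rich E r n U W × Rich E r n W U)
  rich-pair r w n a U big few rich =
    let T , T∈ , 0<UT , good = dependent-random-choice V (tuples V r) (λ R x → U x ∧ all (E x) R)
                                 w n 0 1 (λ T → ⟦ all U T ⟧) (λ T → ⟦⟧≤1 (all U T)) enough
        UT  = 0<⟦⟧⇒true (all U T) 0<UT
        ∣T∣ = ∈-tuples⇒length V w T∈
    in (λ v → all (E v) T)
     , (λ R ∣R∣ UR → ≤-trans
          (rich (R ++ T) (trans (length-++ R) (cong₂ _+_ ∣R∣ ∣T∣))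
                (trans (all-++ U R T) (cong₂ _∧_ UR UT)))
          (≤-reflexive (cnt-cong V (λ v → trans (all-++ (E v) R T) (∧-comm (all (E v) R) _)))))
     -- If `R` lies in the neighbourhood of `T`, then `T` lies in `U` and in the neighbourhood of
     -- `R`. So `R` lies over `T` and cannot be bad.
     , (λ R ∣R∣ hR → good (∈V^ R ∣R∣)
          (trans (all-∧ U (λ x → all (E x) R) T) (cong₂ _∧_ UT (trans (all-E-swap R T) hR))))
    where
    enough : 0 * length V ^ w + 1 * (length (tuples V r) * n ^ w) < ∑ (tuples V w) (λ T → ⟦ all U T ⟧)
    enough rewrite length-tuples V r | ∣V∣ | cnt-tuples V U w | +-identityʳ (M ^ r * n ^ w) =
      *-cancelˡ-< (a ^ w) _ _ (<-≤-trans few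
        (≤-trans (^-monoˡ-≤ w (<⇒≤ big)) (≤-reflexive (^-distribʳ-* w a (cnt V U)))))

-- Greedy embedding into a rich pair.

cnt-mono : (xs : List A) {p q : A → Bool} → (∀ x → p x ≡ true → q x ≡ true) → cnt xs p ≤ cnt xs q
cnt-mono xs {p} {q} imp = ∑-mono xs le
  where
  le : ∀ x → ⟦ p x ⟧ ≤ ⟦ q x ⟧
  le x with p x in eq
  ... | false = z≤n
  ... | true rewrite imp x eq = ≤-refl

all-replicate : (p : A → Bool) (k : ℕ) {x : A} → p x ≡ true → all p (replicate k x) ≡ true
all-replicate p zero    px = refl
all-replicate p (suc k) px rewrite px = all-replicate p k px

-- Padding with copies of `d` brings the length to `r` and can only shrink the common neighbourhood.
Rich-≤ : ∀ {M} {E : Fin M → Fin M → Bool} {r n U W d} → Rich E r n U W → U d ≡ true →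
  ∀ R → length R ≤ r → all U R ≡ true → n ≤ cnt (allFin M) (λ x → W x ∧ all (E x) R)
Rich-≤ {M} {E} {r} {n} {U} {W} {d} rich Ud R ∣R∣≤r UR =
  ≤-trans (rich (R ++ pad)
            (trans (length-++ R) (trans (cong (length R +_) (length-replicate _)) (m+[n∸m]≡n ∣R∣≤r)))
            (trans (all-++ U R pad) (cong₂ _∧_ UR (all-replicate U (r ∸ length R) Ud))))
          (cnt-mono (allFin M) drop-pad)
  where
  pad = replicate (r ∸ length R) d

  drop-pad : ∀ x → W x ∧ all (E x) (R ++ pad) ≡ true → W x ∧ all (E x) R ≡ true
  drop-pad x h =
    let Wx , ER++ = ∧-true {W x} h
        ER , _    = ∧-true {all (E x) R} (trans (sym (all-++ (E x) R pad)) ER++)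
    in cong₂ _∧_ Wx ER

cnt-singleton : ∀ {n} (y : Fin n) {xs : List (Fin n)} → Unique xs → cnt xs (λ x → does (y Fin.≟ x)) ≤ 1
cnt-singleton y [] = z≤n
cnt-singleton y {x ∷ xs} (x∉xs ∷ u) with y Fin.≟ x
... | no  _    = cnt-singleton y u
... | yes refl = s≤s (≤-reflexive (absent x∉xs))
  where
  absent : ∀ {zs} → All (y ≢_) zs → cnt zs (λ z → does (y Fin.≟ z)) ≡ 0
  absent []                       = refl
  absent {z ∷ zs} (y≢z ∷ y∉zs) with y Fin.≟ z
  ... | yes y≡z = contradiction y≡z y≢z
  ... | no  _   = absent y∉zs

-- Pigeonhole by averaging: some `x` has `hits x < ⟦ p x ⟧`, and as the right side is at most 1,
-- this forces both `p x` and `hits x = 0`.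
fresh-value : ∀ {n M} (P : Fin n → Bool) (f : Fin n → Fin M) (p : Fin M → Bool) →
  count n P < cnt (allFin M) p →
  ∃[ x ] (p x ≡ true × (∀ v → P v ≡ true → f v ≢ x))
fresh-value {n} {M} P f p lt =
  let x , _ , hits< = ∑-<⇒∃< (allFin M) hits (λ x → ⟦ p x ⟧) (≤-<-trans total lt)
  in x , 0<⟦⟧⇒true (p x) (≤-<-trans z≤n hits<)
       , λ v Pv fv≡x → contradiction (<-≤-trans hits< (⟦⟧≤1 (p x))) (≤⇒≯ (hit v x Pv fv≡x))
  where
  hits : Fin M → ℕ
  hits x = ∑ (allFin n) (λ v → ⟦ P v ⟧ * ⟦ does (f v Fin.≟ x) ⟧)

  hit : ∀ v x → P v ≡ true → f v ≡ x → 1 ≤ hits x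
  hit v x Pv fv≡x = subst (_≤ hits x)
    (cong₂ (λ b c → ⟦ b ⟧ * ⟦ c ⟧) Pv (dec-true (f v Fin.≟ x) fv≡x))
    (∈⇒≤∑ (λ v → ⟦ P v ⟧ * ⟦ does (f v Fin.≟ x) ⟧) (∈-allFin v))

  total : ∑ (allFin M) hits ≤ count n P
  total = begin
    ∑ (allFin M) hits
      ≡⟨ ∑-swap (allFin M) (allFin n) _ ⟩
    ∑ (allFin n) (λ v → ∑ (allFin M) (λ x → ⟦ P v ⟧ * ⟦ does (f v Fin.≟ x) ⟧))
      ≡⟨ ∑-cong (allFin n) (λ v → ∑-*ˡ (allFin M) ⟦ P v ⟧ _) ⟩
    ∑ (allFin n) (λ v → ⟦ P v ⟧ * cnt (allFin M) (λ x → does (f v Fin.≟ x)))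
      ≤⟨ ∑-mono (allFin n) (λ v → *-monoʳ-≤ ⟦ P v ⟧ (cnt-singleton (f v) (allFin⁺ M))) ⟩
    ∑ (allFin n) (λ v → ⟦ P v ⟧ * 1)
      ≡⟨ ∑-cong (allFin n) (λ v → *-identityʳ ⟦ P v ⟧) ⟩
    count n P ∎
    where open ≤-Reasoning

length-filterᵇ : (p : A → Bool) (xs : List A) → length (filterᵇ p xs) ≡ cnt xs p
length-filterᵇ p []       = refl
length-filterᵇ p (x ∷ xs) with p x
... | true  = cong suc (length-filterᵇ p xs)
... | false = length-filterᵇ p xs

all-map : (p : B → Bool) (f : A → B) (xs : List A) → all p (map f xs) ≡ all (p ∘ f) xs
all-map p f []       = refl
all-map p f (x ∷ xs) = cong (p (f x) ∧_) (all-map p f xs)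

all-filterᵇ⁺ : (p q : A → Bool) (xs : List A) → (∀ x → p x ≡ true → q x ≡ true) →
               all q (filterᵇ p xs) ≡ true
all-filterᵇ⁺ p q []       imp = refl
all-filterᵇ⁺ p q (x ∷ xs) imp with p x in eq
... | true  = cong₂ _∧_ (imp x eq) (all-filterᵇ⁺ p q xs imp)
... | false = all-filterᵇ⁺ p q xs imp

∈-filterᵇ : (p : A → Bool) {x : A} {xs : List A} → x ∈ xs → p x ≡ true → x ∈ filterᵇ p xs
∈-filterᵇ p (here refl) px rewrite px = here refl
∈-filterᵇ p (there {x = y} x∈) px with p y
... | true  = there (∈-filterᵇ p x∈ px)
... | false = ∈-filterᵇ p x∈ px

count-delete : ∀ {n} (P : Fin n → Bool) (u : Fin n) → P u ≡ true →
  count n (λ v → P v ∧ not (does (v Fin.≟ u))) < count n P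
count-delete {n} P u Pu = begin-strict
  count n P′
    <⟨ m<n+m _ 1≤here ⟩
  count n at + count n P′
    ≡⟨ ∑-+ (allFin n) _ _ ⟨
  ∑ (allFin n) (λ v → ⟦ at v ⟧ + ⟦ P′ v ⟧)
    ≡⟨ ∑-cong (allFin n) (λ v → sym (split (P v) (does (v Fin.≟ u)))) ⟩
  count n P ∎
  where
  open ≤-Reasoning
  P′ at : Fin n → Bool
  P′ v = P v ∧ not (does (v Fin.≟ u))
  at v = P v ∧ does (v Fin.≟ u)

  split : ∀ a b → ⟦ a ⟧ ≡ ⟦ a ∧ b ⟧ + ⟦ a ∧ not b ⟧
  split true  true  = refl
  split true  false = refl
  split false _     = refl

  1≤here : 1 ≤ count n at
  1≤here = subst (_≤ count n at) (cong₂ (λ b c → ⟦ b ∧ c ⟧) Pu (dec-true (u Fin.≟ u) refl))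
                 (∈⇒≤∑ (λ v → ⟦ at v ⟧) (∈-allFin u))

induced : ∀ {n} (H : Graph n) → (Fin n → Bool) → Subgraph H
induced H P = record
  { verts   = P
  ; edges   = λ u v → Adj H u v ∧ (P u ∧ P v)
  ; esym    = λ u v → cong₂ _∧_ (Graph.sym H u v) (∧-comm (P u) (P v))
  ; e⊆Adj   = λ u v h → proj₁ (∧-true h)
  ; e⊆verts = λ u v h → ∧-true (proj₂ (∧-true {Adj H u v} h))
  }

-- A partial embedding with domain `P`. The map is total with arbitrary values off `P`, so a vertex
-- is added by overriding one value.
record EmbedsOn {n M : ℕ} (H : Graph n) (E : Fin M → Fin M → Bool) (U : Fin n → Fin M → Bool)
                (P : Fin n → Bool) (f : Fin n → Fin M) : Set where
  field
    inside    : ∀ u → P u ≡ true → U u (f u) ≡ true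
    injective : ∀ u v → P u ≡ true → P v ≡ true → f u ≡ f v → u ≡ v
    preserves : ∀ u v → P u ≡ true → P v ≡ true → Adj H u v ≡ true → E (f u) (f v) ≡ true

module _ {n M r : ℕ} (H : Graph n) (degenerate : Degenerate r H)
         (χ : Fin n → Bool) (proper : ∀ u v → Adj H u v ≡ true → χ u ≢ χ v)
         (E : Fin M → Fin M → Bool) (E-sym : ∀ x y → E x y ≡ E y x)
         (U : Bool → Fin M → Bool)
         (rich : ∀ b R → length R ≤ r → all (U (not b)) R ≡ true →
                 n ≤ cnt (allFin M) (λ x → U b x ∧ all (E x) R))
         (d : Fin M) where

  -- Since `χ` is proper, the neighbours of `u` in `P`, at most `r` of them, all have their images
  -- in the set opposite to that of `u`. Richness gives `n` candidates for `u`, and one of them is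
  -- free.
  embed-extend : (P : Fin n → Bool) (u : Fin n) → P u ≡ true → degIn (induced H P) u ≤ r →
    (f : Fin n → Fin M) → EmbedsOn H E (U ∘ χ) (λ v → P v ∧ not (does (v Fin.≟ u))) f →
    ∃ (EmbedsOn H E (U ∘ χ) P)
  embed-extend P u Pu deg≤r f emb = f⁺ , record
    { inside    = inside⁺
    ; injective = injective⁺
    ; preserves = preserves⁺
    }
    where
    open EmbedsOn emb

    P′ : Fin n → Bool
    P′ v = P v ∧ not (does (v Fin.≟ u))

    edge : Fin n → Bool
    edge = edges (induced H P) u

    nbrs : List (Fin n)
    nbrs = filterᵇ edge (allFin n)

    edge⇒P′ : ∀ v → edge v ≡ true → P′ v ≡ true
    edge⇒P′ v h = cong₂ _∧_ (proj₂ (∧-true {P u} (proj₂ (∧-true {Adj H u v} h))))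
                            (cong not (dec-false (v Fin.≟ u) v≢u))
      where
      v≢u : v ≢ u
      v≢u refl with () ← trans (sym (irrefl H u)) (proj₁ (∧-true h))

    edge⇒U : ∀ v → edge v ≡ true → U (not (χ u)) (f v) ≡ true
    edge⇒U v h = subst (λ b → U b (f v) ≡ true)
                       (Bool.¬-not (proper u v (proj₁ (∧-true h)) ∘ sym))
                       (inside v (edge⇒P′ v h))

    enough : n ≤ cnt (allFin M) (λ x → U (χ u) x ∧ all (E x) (map f nbrs))
    enough = rich (χ u) (map f nbrs)
      (≤-trans (≤-reflexive (trans (length-map f nbrs) (length-filterᵇ edge (allFin n)))) deg≤r)
      (trans (all-map _ f nbrs) (all-filterᵇ⁺ edge _ (allFin n) edge⇒U))

    -- Strict because `u` itself is not yet placed; this is why `n` candidates are enough.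
    used<n : count n P′ < n
    used<n = <-≤-trans (count-delete P u Pu)
               (≤-trans (cnt≤length (allFin n) P) (≤-reflexive (length-tabulate {n = n} id)))

    choice = fresh-value P′ f _ (<-≤-trans used<n enough)

    x : Fin M
    x = proj₁ choice

    Ux : U (χ u) x ≡ true
    Ux = proj₁ (∧-true (proj₁ (proj₂ choice)))

    x-new : ∀ v → P′ v ≡ true → f v ≢ x
    x-new = proj₂ (proj₂ choice)

    x~ : ∀ v → P′ v ≡ true → Adj H u v ≡ true → E x (f v) ≡ true
    x~ v P′v uv = all-∈ {p = E x ∘ f} {xs = nbrs}
      (trans (sym (all-map (E x) f nbrs)) (proj₂ (∧-true {U (χ u) x} (proj₁ (proj₂ choice)))))
      (∈-filterᵇ edge (∈-allFin v) (cong₂ _∧_ uv (cong₂ _∧_ Pu (proj₁ (∧-true P′v)))))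

    f⁺ : Fin n → Fin M
    f⁺ v = if does (v Fin.≟ u) then x else f v

    split : ∀ v → P v ≡ true → (v ≡ u × f⁺ v ≡ x) ⊎ (P′ v ≡ true × f⁺ v ≡ f v)
    split v Pv with v Fin.≟ u
    ... | yes v≡u = inj₁ (v≡u , refl)
    ... | no  _   = inj₂ (trans (∧-identityʳ (P v)) Pv , refl)

    inside⁺ : ∀ v → P v ≡ true → U (χ v) (f⁺ v) ≡ true
    inside⁺ v Pv with split v Pv
    ... | inj₁ (refl , eq) rewrite eq = Ux
    ... | inj₂ (P′v  , eq) rewrite eq = inside v P′v

    injective⁺ : ∀ v w → P v ≡ true → P w ≡ true → f⁺ v ≡ f⁺ w → v ≡ w
    injective⁺ v w Pv Pw h with split v Pv | split w Pw
    ... | inj₁ (refl , _)  | inj₁ (refl , _)   = refl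
    ... | inj₁ (_ , eq)    | inj₂ (P′w , eq′) = contradiction (trans (sym eq′) (trans (sym h) eq)) (x-new w P′w)
    ... | inj₂ (P′v , eq) | inj₁ (_ , eq′)    = contradiction (trans (sym eq) (trans h eq′)) (x-new v P′v)
    ... | inj₂ (P′v , eq) | inj₂ (P′w , eq′) = injective v w P′v P′w (trans (sym eq) (trans h eq′))

    preserves⁺ : ∀ v w → P v ≡ true → P w ≡ true → Adj H v w ≡ true → E (f⁺ v) (f⁺ w) ≡ true
    preserves⁺ v w Pv Pw vw with split v Pv | split w Pw
    ... | inj₁ (refl , _) | inj₁ (refl , _) with () ← trans (sym (irrefl H v)) vw
    preserves⁺ v w Pv Pw vw | inj₁ (refl , eq) | inj₂ (P′w , eq′) =
      trans (cong₂ E eq eq′) (x~ w P′w vw)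
    preserves⁺ v w Pv Pw vw | inj₂ (P′v , eq) | inj₁ (refl , eq′) =
      trans (cong₂ E eq eq′) (trans (E-sym (f v) x) (x~ v P′v (trans (Graph.sym H w v) vw)))
    preserves⁺ v w Pv Pw vw | inj₂ (P′v , eq) | inj₂ (P′w , eq′) =
      trans (cong₂ E eq eq′) (preserves v w P′v P′w vw)

  -- The degeneracy order arises during the recursion: a vertex of degree at most `r` in the graph
  -- induced on `P` is placed after the rest of `P`. The bound `m` makes the recursion structural.
  embed : ∀ m (P : Fin n → Bool) → count n P ≤ m → ∃ (EmbedsOn H E (U ∘ χ) P)
  embed m P size with Fin.any? (λ u → P u Bool.≟ true)
  -- `d` is a dummy value: with `P` empty, every condition is vacuous.
  ... | no none = (λ _ → d) , record
    { inside    = λ u Pu → ⊥-elim (none (u , Pu))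
    ; injective = λ u _ Pu → ⊥-elim (none (u , Pu))
    ; preserves = λ u _ Pu → ⊥-elim (none (u , Pu))
    }
  ... | yes some with degenerate (induced H P) some | m
  ...   | u , Pu , deg≤r | zero  = contradiction (<-≤-trans (count-delete P u Pu) size) λ ()
  ...   | u , Pu , deg≤r | suc m′ =
    let f , emb = embed m′ _ (s≤s⁻¹ (<-≤-trans (count-delete P u Pu) size))
    in embed-extend P u Pu deg≤r f emb

-- A colour with a large degree moment.

^-+-≤ : ∀ k a b → (a + b) ^ k ≤ 2 ^ k * (a ^ k + b ^ k)
^-+-≤ k a b with ≤-total a b
... | inj₁ a≤b = begin
  (a + b) ^ k             ≤⟨ ^-monoˡ-≤ k (+-monoˡ-≤ b a≤b) ⟩
  (b + b) ^ k             ≡⟨ cong (λ z → (b + z) ^ k) (+-identityʳ b) ⟨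
  (2 * b) ^ k             ≡⟨ ^-distribʳ-* k 2 b ⟩
  2 ^ k * b ^ k           ≤⟨ *-monoʳ-≤ (2 ^ k) (m≤n+m (b ^ k) (a ^ k)) ⟩
  2 ^ k * (a ^ k + b ^ k) ∎
  where open ≤-Reasoning
... | inj₂ b≤a = begin
  (a + b) ^ k             ≤⟨ ^-monoˡ-≤ k (+-monoʳ-≤ a b≤a) ⟩
  (a + a) ^ k             ≡⟨ cong (λ z → (a + z) ^ k) (+-identityʳ a) ⟨
  (2 * a) ^ k             ≡⟨ ^-distribʳ-* k 2 a ⟩
  2 ^ k * a ^ k           ≤⟨ *-monoʳ-≤ (2 ^ k) (m≤m+n (a ^ k) (b ^ k)) ⟩
  2 ^ k * (a ^ k + b ^ k) ∎
  where open ≤-Reasoning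

+≤⇒half : ∀ {s} (f : Bool → ℕ) → s ≤ f true + f false → ∃[ b ] s ≤ 2 * f b
+≤⇒half f le with ≤-total (f true) (f false)
... | inj₁ t≤f = false , ≤-trans le (+-mono-≤ t≤f (≤-reflexive (sym (+-identityʳ _))))
... | inj₂ f≤t = true  , ≤-trans le (+-monoʳ-≤ (f true) (≤-trans f≤t (≤-reflexive (sym (+-identityʳ _)))))

module _ {M : ℕ} (c : Fin M → Fin M → Bool) where

  colourClass : Bool → Fin M → Fin M → Bool
  colourClass b x y = does (c x y Bool.≟ b)

  -- At each vertex the two degrees add up to `M`, so `^-+-≤` bounds `M ^ k` by `2 ^ k` times the
  -- sum of their `k`-th powers. Summing over vertices and keeping the better colour costs one more
  -- factor 2.
  dense-colour : ∀ k → ∃[ b ] M ^ suc k ≤ 2 ^ suc k * ∑ (allFin M) (λ v → cnt (allFin M) (colourClass b v) ^ k)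
  dense-colour k =
    let b , le = +≤⇒half moment split in b , ≤-trans le (≤-reflexive (double (2 ^ k) _))
    where
    open ≤-Reasoning
    V = allFin M

    deg : Bool → Fin M → ℕ
    deg b v = cnt V (colourClass b v)

    moment : Bool → ℕ
    moment b = 2 ^ k * ∑ V (λ v → deg b v ^ k)

    double : ∀ a b → 2 * (a * b) ≡ 2 * a * b
    double = solve-∀

    complementary : ∀ b → ⟦ does (b Bool.≟ true) ⟧ + ⟦ does (b Bool.≟ false) ⟧ ≡ 1
    complementary true  = refl
    complementary false = refl

    -- The diagonal entry `c v v` is counted too, so the sum is `M` rather than `M - 1`.
    deg-sum : ∀ v → deg true v + deg false v ≡ M
    deg-sum v = begin-equality
      deg true v + deg false v ≡⟨ ∑-+ V _ _ ⟨
      ∑ V (λ x → ⟦ colourClass true v x ⟧ + ⟦ colourClass false v x ⟧)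
                               ≡⟨ ∑-cong V (λ x → complementary (c v x)) ⟩
      ∑ V (λ _ → 1)            ≡⟨ ∑-const V 1 ⟩
      length V * 1             ≡⟨ *-identityʳ _ ⟩
      length V                 ≡⟨ length-tabulate id ⟩
      M                        ∎

    split : M ^ suc k ≤ moment true + moment false
    split = begin
      M * M ^ k
        ≡⟨ cong (_* M ^ k) (length-tabulate {n = M} id) ⟨
      length V * M ^ k
        ≡⟨ ∑-const V (M ^ k) ⟨
      ∑ V (λ _ → M ^ k)
        ≤⟨ ∑-mono V (λ v → subst (λ z → z ^ k ≤ 2 ^ k * (deg true v ^ k + deg false v ^ k)) (deg-sum v)
                                 (^-+-≤ k (deg true v) (deg false v))) ⟩
      ∑ V (λ v → 2 ^ k * (deg true v ^ k + deg false v ^ k))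
        ≡⟨ ∑-*ˡ V (2 ^ k) _ ⟩
      2 ^ k * ∑ V (λ v → deg true v ^ k + deg false v ^ k)
        ≡⟨ cong (2 ^ k *_) (∑-+ V _ _) ⟩
      2 ^ k * (∑ V (λ v → deg true v ^ k) + ∑ V (λ v → deg false v ^ k))
        ≡⟨ *-distribˡ-+ (2 ^ k) _ _ ⟩
      moment true + moment false ∎

-- From a dense colour to a monochromatic copy.

does-true : {P : Set} (P? : Dec P) → does P? ≡ true → P
does-true (yes p) _ = p

-- The last two numerical hypotheses make bad tuples rare in the two random choices:
-- `(r + w)`-tuples in the first, `r`-tuples in the second. The factor `2 ^ (2 + k)` in the latter
-- comes from the density of `U₁`.
ramsey-property : ∀ {n r} (H : Graph n) → Degenerate r H → Bipartite H → ∀ k w M → 1 ≤ n → 1 ≤ M →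
  2 ^ (2 + k) * (M ^ (r + w) * n ^ k) < M ^ k →
  (2 ^ (2 + k)) ^ w * (M ^ r * n ^ w) < M ^ w →
  RamseyProp H M
ramsey-property {n} {r} H degenerate (χ , proper) k w M 1≤n 1≤M few₁ few₂ (c , c-sym) =
  b , f , (λ {x} {y} → injective x y refl refl)
    , λ u v uv → does-true (c (f u) (f v) Bool.≟ b) (preserves u v refl refl uv)
  where
  V = allFin M
  b = proj₁ (dense-colour c k)
  E = colourClass c b

  E-sym : ∀ x y → E x y ≡ E y x
  E-sym x y = cong (λ z → does (z Bool.≟ b)) (c-sym x y)

  stage₁ = large-common-neighbourhood E E-sym k (r + w) n (proj₂ (dense-colour c k)) 1≤M few₁

  U₁ : Fin M → Bool
  U₁ v = all (E v) (proj₁ stage₁)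

  stage₂ = rich-pair E E-sym r w n (2 ^ (2 + k)) U₁ (proj₁ (proj₂ stage₁)) few₂ (proj₂ (proj₂ stage₁))

  U₂ : Fin M → Bool
  U₂ = proj₁ stage₂

  rich₁₂ = proj₁ (proj₂ stage₂)
  rich₂₁ = proj₂ (proj₂ stage₂)

  U₁-nonempty : ∃[ d ] U₁ d ≡ true
  U₁-nonempty = 0<cnt⇒∃ V U₁ (n≢0⇒n>0 λ eq → contradiction (proj₁ (proj₂ stage₁))
    (≤⇒≯ (≤-trans (≤-reflexive (trans (cong (2 ^ (2 + k) *_) eq) (*-zeroʳ (2 ^ (2 + k))))) z≤n)))

  U₂-nonempty : ∃[ d ] U₂ d ≡ true
  -- Padding needs a vertex on each side. Here `r` copies of a vertex of `U₁` have at least `n`,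
  -- hence at least one, common neighbours in `U₂`.
  U₂-nonempty =
    let d₁ , U₁d₁ = U₁-nonempty
        d₂ , h    = 0<cnt⇒∃ V _ (≤-trans 1≤n
                      (rich₁₂ (replicate r d₁) (length-replicate r) (all-replicate U₁ r U₁d₁)))
    in d₂ , proj₁ (∧-true h)

  U : Bool → Fin M → Bool
  U true  = U₁
  U false = U₂

  rich : ∀ s R → length R ≤ r → all (U (not s)) R ≡ true → n ≤ cnt V (λ x → U s x ∧ all (E x) R)
  rich true  = Rich-≤ rich₂₁ (proj₂ U₂-nonempty)
  rich false = Rich-≤ rich₁₂ (proj₂ U₁-nonempty)

  embedding = embed H degenerate χ proper E E-sym U rich (proj₁ U₁-nonempty) (count n (λ _ → true)) (λ _ → true) ≤-refl

  f : Fin n → Fin M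
  f = proj₁ embedding

  open EmbedsOn (proj₂ embedding)

-- Exhaustive search and the existence of Ramsey numbers.

Searchable : Set → Set₁
Searchable A = {P : A → Set} → Decidable P → Dec (Σ A P)

search-Bool : Searchable Bool
search-Bool P? with P? true | P? false
... | yes p | _     = yes (true , p)
... | no _  | yes p = yes (false , p)
... | no ¬t | no ¬f = no λ where (true , p) → ¬t p
                                 (false , p) → ¬f p

search-Vec : Searchable A → ∀ n → Searchable (Vec A n)
search-Vec search zero    P? = map′ (λ p → [] , p) (λ where ([] , p) → p) (P? [])
search-Vec search (suc n) P? =
  map′ (λ (x , xs , p) → x ∷ xs , p) (λ where (x ∷ xs , p) → x , xs , p)
       (search (λ x → search-Vec search n (λ xs → P? (x ∷ xs))))

-- A map is represented by its vector of values. The conditions depend only on values, so they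
-- transfer along `tabulate` and `lookup` pointwise.
MonoCopy? : ∀ {n} (H : Graph n) {N} (c : EdgeColouring N) → Dec (MonoCopy H c)
MonoCopy? {n} H {N} (c , _) = search-Bool λ b → map′ decode encode (search-Vec Fin.any? n (λ v →
    Fin.all? (λ x → Fin.all? λ y → (Vec.lookup v x Fin.≟ Vec.lookup v y) →-dec (x Fin.≟ y))
    ×-dec
    Fin.all? (λ x → Fin.all? λ y → (Adj H x y Bool.≟ true) →-dec (c (Vec.lookup v x) (Vec.lookup v y) Bool.≟ b))))
  where
  Good : Bool → (Fin n → Fin N) → Set
  Good b f = (∀ x y → f x ≡ f y → x ≡ y) × (∀ x y → Adj H x y ≡ true → c (f x) (f y) ≡ b)

  decode : ∀ {b} → ∃ (λ v → Good b (Vec.lookup v)) →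
           Σ (Fin n → Fin N) λ f → Injective _≡_ _≡_ f × (∀ x y → Adj H x y ≡ true → c (f x) (f y) ≡ b)
  decode (v , inj , col) = Vec.lookup v , (λ {x} {y} → inj x y) , col

  encode : ∀ {b} → (Σ (Fin n → Fin N) λ f → Injective _≡_ _≡_ f × (∀ x y → Adj H x y ≡ true → c (f x) (f y) ≡ b)) →
           ∃ (λ v → Good b (Vec.lookup v))
  encode {b} (f , inj , col) = Vec.tabulate f
    , (λ x y eq → inj (trans (sym (Vec.lookup∘tabulate f x)) (trans eq (Vec.lookup∘tabulate f y))))
    , (λ x y xy → subst (_≡ b) (sym (cong₂ c (Vec.lookup∘tabulate f x) (Vec.lookup∘tabulate f y))) (col x y xy))

-- Every colouring is the symmetrisation of its own matrix, so finitely many matrices suffice.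
symmetrise : ∀ {N} → Vec (Vec Bool N) N → EdgeColouring N
symmetrise m = (λ i j → entry i j ∨ entry j i) , (λ i j → ∨-comm (entry i j) (entry j i))
  where entry = λ i j → Vec.lookup (Vec.lookup m i) j

-- The search is for a matrix whose colouring has no monochromatic copy. If there is none,
-- decidability of `MonoCopy` removes the double negation.
RamseyProp? : ∀ {n} (H : Graph n) N → Dec (RamseyProp H N)
RamseyProp? H N = map′ sound (λ prop (m , none) → none (prop (symmetrise m)))
  (¬? (search-Vec (search-Vec search-Bool N) N (λ m → ¬? (MonoCopy? H (symmetrise m)))))
  where
  sound : ¬ (∃ λ m → ¬ MonoCopy H (symmetrise m)) → RamseyProp H N
  sound none (c , c-sym) =
    let b , f , inj , col = decidable-stable (MonoCopy? H (symmetrise m)) (λ no-copy → none (m , no-copy))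
    in b , f , inj , λ u v uv → trans (sym (same (f u) (f v))) (col u v uv)
    where
    m : Vec (Vec Bool N) N
    m = Vec.tabulate (λ i → Vec.tabulate (c i))

    entry : ∀ i j → Vec.lookup (Vec.lookup m i) j ≡ c i j
    entry i j = trans (cong (λ row → Vec.lookup row j) (Vec.lookup∘tabulate (λ i → Vec.tabulate (c i)) i))
                      (Vec.lookup∘tabulate (c i) j)

    same : ∀ i j → proj₁ (symmetrise m) i j ≡ c i j
    same i j = trans (cong₂ _∨_ (entry i j) (trans (entry j i) (c-sym j i))) (∨-idem (c i j))

-- Provides the integer cube root and the integer logarithm: walk up from `a` until the next step
-- fails, with `d` bounding the walk.
last-before-failure : {P : ℕ → Set} → Decidable P → ∀ a d → P a → ¬ P (a + d) →
                      ∃[ m ] (a ≤ m × P m × ¬ P (suc m))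
last-before-failure {P} P? a zero    Pa ¬P = contradiction (subst P (sym (+-identityʳ a)) Pa) ¬P
last-before-failure {P} P? a (suc d) Pa ¬P with P? (suc a)
... | no ¬Psa = a , ≤-refl , Pa , ¬Psa
... | yes Psa = let m , a<m , rest = last-before-failure P? (suc a) d Psa (¬P ∘ subst P (sym (+-suc a d)))
                in m , <⇒≤ a<m , rest

least : {P : ℕ → Set} → Decidable P → ∀ m → P m → ∃[ l ] (P l × (∀ k → P k → l ≤ k))
least {P} P? m Pm with search-below m
  where
  search-below : ∀ b → (∃[ l ] (P l × (∀ k → P k → l ≤ k))) ⊎ (∀ k → P k → b ≤ k)
  search-below zero    = inj₂ λ _ _ → z≤n
  search-below (suc b) with search-below b
  ... | inj₁ found = inj₁ found
  ... | inj₂ none with P? b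
  ...   | yes Pb = inj₁ (b , Pb , none)
  ...   | no ¬Pb = inj₂ λ k Pk → ≤∧≢⇒< (none k Pk) λ where refl → ¬Pb Pk
... | inj₁ found = found
... | inj₂ none  = m , Pm , none

ramsey-number : ∀ {n} (H : Graph n) M → 1 ≤ M → RamseyProp H M → ∃[ N ] (IsRamseyNumber H N × N ≤ M)
ramsey-number H M 1≤M prop =
  let N , (1≤N , propN) , min = least (λ N → (1 ≤? N) ×-dec RamseyProp? H N) M (1≤M , prop)
  in N , (1≤N , propN , λ K 1≤K propK → min K (1≤K , propK)) , min M (1≤M , prop)

-- Integer estimates and the choice of parameters.

n<2^n : ∀ n → n < 2 ^ n
n<2^n zero    = ≤-refl
n<2^n (suc n) = begin
  suc (suc n)       ≤⟨ s≤s (n<2^n n) ⟩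
  1 + 2 ^ n         ≤⟨ +-mono-≤ (m^n>0 2 n) (≤-reflexive (sym (+-identityʳ (2 ^ n)))) ⟩
  2 ^ n + (2 ^ n + 0) ∎
  where open ≤-Reasoning

-- Both rarity conditions have this shape with `M = n * 2 ^ s`. Bounding `M ^ q` through `M ≤ 2 ^ Λ`
-- and taking `n ^ j` out of both sides leaves a comparison of exponents of 2.
power-gap : ∀ n s Λ c q j → 1 ≤ n → n * 2 ^ s ≤ 2 ^ Λ → c + Λ * q < s * j →
            2 ^ c * ((n * 2 ^ s) ^ q * n ^ j) < (n * 2 ^ s) ^ j
power-gap n s Λ c q j 1≤n M≤ gap = begin-strict
  2 ^ c * ((n * 2 ^ s) ^ q * n ^ j)
    ≤⟨ *-monoʳ-≤ (2 ^ c) (*-monoˡ-≤ (n ^ j) (^-monoˡ-≤ q M≤)) ⟩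
  2 ^ c * ((2 ^ Λ) ^ q * n ^ j)
    ≡⟨ cong (λ z → 2 ^ c * (z * n ^ j)) (^-*-assoc 2 Λ q) ⟩
  2 ^ c * (2 ^ (Λ * q) * n ^ j)
    ≡⟨ rearrange (2 ^ c) _ (n ^ j) ⟩
  n ^ j * (2 ^ c * 2 ^ (Λ * q))
    ≡⟨ cong (n ^ j *_) (^-distribˡ-+-* 2 c (Λ * q)) ⟨
  n ^ j * 2 ^ (c + Λ * q)
    <⟨ *-monoʳ-< (n ^ j) {{m^n≢0 n j {{>-nonZero 1≤n}}}} (^-monoʳ-< 2 ≤-refl gap) ⟩
  n ^ j * 2 ^ (s * j)
    ≡⟨ cong (n ^ j *_) (^-*-assoc 2 s j) ⟨
  n ^ j * (2 ^ s) ^ j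
    ≡⟨ ^-distribʳ-* j n (2 ^ s) ⟨
  (n * 2 ^ s) ^ j ∎
  where
  open ≤-Reasoning
  rearrange : ∀ a b c → a * (b * c) ≡ c * (a * b)
  rearrange = solve-∀

-- At `k = 4` the ratio of the cubes is 125/64, and it decreases with `k`; at 3 it is 64/27, too
-- large. Substituting `k = 4 + j` leaves a difference with nonnegative coefficients.
suc^3≤2*^3 : ∀ k → 4 ≤ k → suc k ^ 3 ≤ 2 * k ^ 3
suc^3≤2*^3 k 4≤k = subst (λ k → suc k ^ 3 ≤ 2 * k ^ 3) (m+[n∸m]≡n 4≤k)
  (≤-trans (m≤m+n _ _) (≤-reflexive (expand (k ∸ 4))))
  where
  expand : ∀ j → (5 + j) * ((5 + j) * ((5 + j) * 1)) + (3 + 21 * j + 9 * (j * j) + j * j * j)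
               ≡ 2 * ((4 + j) * ((4 + j) * ((4 + j) * 1)))
  expand = solve-∀

-- For `M = n * 2 ^ (4 * k)`, the clauses serve in turn the final bound, the estimate
-- `M ≤ 2 ^ (2 * ℓ)`, and the two rarity conditions in the exponent form of `power-gap`.
Admissible : (r ℓ k w : ℕ) → Set
Admissible r ℓ k w =
  k ^ 3 ≤ 8 * (r * ℓ ^ 2) × suc ℓ + 4 * k ≤ 2 * ℓ ×
  (2 + k) + (2 * ℓ) * (r + w) < (4 * k) * k × (2 + k) * w + (2 * ℓ) * r < (4 * k) * w

cube-root : ∀ r ℓ → 1 ≤ r → r * 4096 ≤ ℓ →
  ∃[ k ] (4 ≤ k × k ^ 3 ≤ 8 * (r * ℓ ^ 2) × ¬ suc k ^ 3 ≤ 8 * (r * ℓ ^ 2))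
cube-root r ℓ 1≤r ℓ-large =
  -- The walk starts at 4 because `suc^3≤2*^3` needs `4 ≤ k`, and ends by `4 + ℓ` because
  -- `8 * r ≤ ℓ`.
  last-before-failure (λ k → k ^ 3 ≤? 8 * (r * ℓ ^ 2)) 4 ℓ cube-4 cube-ℓ
  where
  open ≤-Reasoning
  4096≤ℓ : 4096 ≤ ℓ
  4096≤ℓ = ≤-trans (*-monoˡ-≤ 4096 1≤r) ℓ-large

  cube-4 : 4 ^ 3 ≤ 8 * (r * ℓ ^ 2)
  cube-4 = ≤-trans (m≤m+n 64 8) (*-monoʳ-≤ 8 (*-mono-≤ 1≤r (^-monoˡ-≤ 2 (≤-trans (m≤m+n 3 4093) 4096≤ℓ))))

  cube-ℓ : ¬ (4 + ℓ) ^ 3 ≤ 8 * (r * ℓ ^ 2)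
  cube-ℓ = <⇒≱ (begin-strict
    8 * (r * ℓ ^ 2)  ≡⟨ swap 8 r (ℓ ^ 2) ⟩
    r * 8 * ℓ ^ 2    ≤⟨ *-monoˡ-≤ (ℓ ^ 2) (≤-trans (*-monoʳ-≤ r (m≤m+n 8 4088)) ℓ-large) ⟩
    ℓ ^ 3            <⟨ ^-monoˡ-< 3 (m<n+m ℓ {4} z<s) ⟩
    (4 + ℓ) ^ 3      ∎)
    where
    swap : ∀ a b c → a * (b * c) ≡ b * a * c
    swap = solve-∀

-- k is the integer cube root of 8rℓ², and w the least integer above 2rℓ/k.
parameters : ∀ r ℓ → 1 ≤ r → r * 4096 ≤ ℓ → ∃[ k ] ∃[ w ] Admissible r ℓ k w
parameters r ℓ 1≤r ℓ-large = k , w , k³≤ , room , gap₁ , gap₂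
  where
  open ≤-Reasoning
  root  = cube-root r ℓ 1≤r ℓ-large
  k     = proj₁ root
  4≤k   = proj₁ (proj₂ root)
  k³≤   = proj₁ (proj₂ (proj₂ root))
  ¬k⁺³≤ = proj₂ (proj₂ (proj₂ root))
  instance
    k≢0 : NonZero k
    k≢0 = >-nonZero (≤-trans (s≤s z≤n) 4≤k)

  -- The `suc` makes `2 * ℓ * r < k * w` strict, as `gap₂` requires, at the cost of an extra `k` in
  -- `kw-upper`.
  w = suc (2 * ℓ * r / k)

  8k≤ℓ : 8 * k ≤ ℓ
  -- This is the source of the threshold 4096, which is 8 cubed times the 8 in the bound on `k ^ 3`.
  8k≤ℓ = ≮⇒≥ λ ℓ<8k → <-irrefl refl (begin-strict
    ℓ ^ 3                    <⟨ ^-monoˡ-< 3 ℓ<8k ⟩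
    (8 * k) ^ 3              ≡⟨ ^-distribʳ-* 3 8 k ⟩
    512 * k ^ 3              ≤⟨ *-monoʳ-≤ 512 k³≤ ⟩
    512 * (8 * (r * ℓ ^ 2))  ≡⟨ *-assoc 512 8 (r * ℓ ^ 2) ⟨
    4096 * (r * ℓ ^ 2)       ≡⟨ *-assoc 4096 r (ℓ ^ 2) ⟨
    4096 * r * ℓ ^ 2         ≡⟨ cong (_* ℓ ^ 2) (*-comm 4096 r) ⟩
    r * 4096 * ℓ ^ 2         ≤⟨ *-monoˡ-≤ (ℓ ^ 2) ℓ-large ⟩
    ℓ ^ 3                    ∎)

  k≤ℓ : k ≤ ℓ
  k≤ℓ = ≤-trans (m≤m+n k (7 * k)) 8k≤ℓ

  room : suc ℓ + 4 * k ≤ 2 * ℓ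
  room = begin
    suc ℓ + 4 * k       ≡⟨ +-suc ℓ (4 * k) ⟨
    ℓ + suc (4 * k)     ≤⟨ +-monoʳ-≤ ℓ (+-monoˡ-≤ (4 * k) (≤-trans (s≤s z≤n) (*-monoʳ-≤ 4 4≤k))) ⟩
    ℓ + (4 * k + 4 * k) ≡⟨ cong (ℓ +_) (eight k) ⟩
    ℓ + 8 * k           ≤⟨ +-monoʳ-≤ ℓ 8k≤ℓ ⟩
    ℓ + ℓ               ≡⟨ cong (ℓ +_) (+-identityʳ ℓ) ⟨
    2 * ℓ               ∎
    where
    eight : ∀ k → 4 * k + 4 * k ≡ 8 * k
    eight = solve-∀

  kw-upper : k * w ≤ k + 2 * ℓ * r
  kw-upper = begin
    k * w                       ≡⟨ *-suc k _ ⟩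
    k + k * (2 * ℓ * r / k)     ≡⟨ cong (k +_) (*-comm k _) ⟩
    k + (2 * ℓ * r / k) * k     ≤⟨ +-monoʳ-≤ k (m/n*n≤m (2 * ℓ * r) k) ⟩
    k + 2 * ℓ * r               ∎

  kw-lower : 2 * ℓ * r < k * w
  kw-lower = begin-strict
    2 * ℓ * r                                 ≡⟨ m≡m%n+[m/n]*n (2 * ℓ * r) k ⟩
    2 * ℓ * r % k + (2 * ℓ * r / k) * k       <⟨ +-monoˡ-< _ (m%n<n (2 * ℓ * r) k) ⟩
    w * k                                     ≡⟨ *-comm w k ⟩
    k * w                                     ∎

  rℓℓ = r * (ℓ * ℓ)

  1≤ℓ : 1 ≤ ℓ
  1≤ℓ = ≤-trans (≤-trans (s≤s z≤n) 4≤k) k≤ℓ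

  ℓℓ≤rℓℓ : ℓ * ℓ ≤ rℓℓ
  ℓℓ≤rℓℓ = m≤n*m (ℓ * ℓ) r {{>-nonZero 1≤r}}

  k≤rℓℓ : k ≤ rℓℓ
  k≤rℓℓ = ≤-trans k≤ℓ (≤-trans (m≤m*n ℓ ℓ {{>-nonZero 1≤ℓ}}) ℓℓ≤rℓℓ)

  gap₁ : (2 + k) + (2 * ℓ) * (r + w) < (4 * k) * k
  -- Multiplying by `k` clears the division in `w`. The left side becomes at most `11 * rℓℓ`, which
  -- is below `16 * rℓℓ`; maximality of `k` puts that below `2 * suc k ^ 3`, which is at most
  -- `4 * k ^ 3`.
  gap₁ = *-cancelˡ-< k _ _ (begin-strict
    k * ((2 + k) + (2 * ℓ) * (r + w))
      ≡⟨ expand k ℓ r w ⟩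
    2 * k + k * k + 2 * (r * (k * ℓ)) + 2 * ℓ * (k * w)
      ≤⟨ +-mono-≤ (+-mono-≤ (+-mono-≤ (*-monoʳ-≤ 2 k≤rℓℓ) (≤-trans (*-mono-≤ k≤ℓ k≤ℓ) ℓℓ≤rℓℓ))
                            (*-monoʳ-≤ 2 (*-monoʳ-≤ r (*-monoˡ-≤ ℓ k≤ℓ))))
                  (*-monoʳ-≤ (2 * ℓ) (≤-trans kw-upper (+-monoˡ-≤ (2 * ℓ * r) k≤ℓ))) ⟩
    2 * rℓℓ + rℓℓ + 2 * rℓℓ + 2 * ℓ * (ℓ + 2 * ℓ * r)
      ≡⟨ collect ℓ r ⟩
    2 * (ℓ * ℓ) + 9 * rℓℓ
      ≤⟨ +-monoˡ-≤ (9 * rℓℓ) (*-monoʳ-≤ 2 ℓℓ≤rℓℓ) ⟩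
    2 * rℓℓ + 9 * rℓℓ
      ≤⟨ m≤m+n _ (5 * rℓℓ) ⟩
    2 * rℓℓ + 9 * rℓℓ + 5 * rℓℓ
      ≡⟨ sixteen ℓ r ⟩
    2 * (8 * (r * ℓ ^ 2))
      <⟨ *-monoʳ-< 2 (≰⇒> ¬k⁺³≤) ⟩
    2 * suc k ^ 3
      ≤⟨ *-monoʳ-≤ 2 (suc^3≤2*^3 k 4≤k) ⟩
    2 * (2 * k ^ 3)
      ≡⟨ cubes k ⟩
    k * (4 * k * k) ∎)
    where
    expand : ∀ k ℓ r w → k * ((2 + k) + (2 * ℓ) * (r + w)) ≡ 2 * k + k * k + 2 * (r * (k * ℓ)) + 2 * ℓ * (k * w)
    expand = solve-∀
    collect : ∀ ℓ r → 2 * (r * (ℓ * ℓ)) + r * (ℓ * ℓ) + 2 * (r * (ℓ * ℓ)) + 2 * ℓ * (ℓ + 2 * ℓ * r)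
                    ≡ 2 * (ℓ * ℓ) + 9 * (r * (ℓ * ℓ))
    collect = solve-∀
    sixteen : ∀ ℓ r → 2 * (r * (ℓ * ℓ)) + 9 * (r * (ℓ * ℓ)) + 5 * (r * (ℓ * ℓ)) ≡ 2 * (8 * (r * (ℓ * (ℓ * 1))))
    sixteen = solve-∀
    cubes : ∀ k → 2 * (2 * (k * (k * (k * 1)))) ≡ k * (4 * k * k)
    cubes = solve-∀

  gap₂ : (2 + k) * w + (2 * ℓ) * r < (4 * k) * w
  gap₂ = begin-strict
    (2 + k) * w + 2 * ℓ * r   <⟨ +-monoʳ-< ((2 + k) * w) kw-lower ⟩
    (2 + k) * w + k * w       ≡⟨ *-distribʳ-+ w (2 + k) k ⟨
    (2 + k + k) * w           ≤⟨ *-monoˡ-≤ w (+-monoˡ-≤ k (+-monoˡ-≤ k (≤-trans (m≤m+n 2 6) (*-monoʳ-≤ 2 4≤k)))) ⟩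
    (2 * k + k + k) * w       ≡⟨ cong (_* w) (four k) ⟩
    (4 * k) * w               ∎
    where
    four : ∀ k → 2 * k + k + k ≡ 4 * k
    four = solve-∀

-- The numerical bound and the conclusion.

2^-cancel-< : ∀ {a b} → 2 ^ a < 2 ^ b → a < b
2^-cancel-< lt = ≰⇒> λ b≤a → <⇒≱ lt (^-monoʳ-≤ 2 b≤a)

-- With N ≤ n 2^{4k}, the witness s/t = ℓ/1 serves every p/q.
ramsey-bound : ∀ {r n N k ℓ} → k ^ 3 ≤ 8 * (r * ℓ ^ 2) → 2 ^ ℓ < n → N ≤ n * 2 ^ (4 * k) → RamseyBound r n N
ramsey-bound {r} {n} {N} {k} {ℓ} k³≤ 2^ℓ<n N≤ p q 1≤q lt =
  ℓ , 1 , ≤-refl , subst (2 ^ ℓ <_) (sym (*-identityʳ n)) 2^ℓ<n , (begin-strict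
    p ^ 3 * 1 ^ 2               ≡⟨ *-identityʳ (p ^ 3) ⟩
    p ^ 3                       <⟨ ^-monoˡ-< 3 p<4kq ⟩
    (4 * k * q) ^ 3             ≡⟨ cubes 4 k q ⟩
    -- The constant 512 arises as 4 cubed, from the exponent `4 * k`, times the 8 in the bound on
    -- `k ^ 3`.
    64 * (q ^ 3 * k ^ 3)        ≤⟨ *-monoʳ-≤ 64 (*-monoʳ-≤ (q ^ 3) k³≤) ⟩
    64 * (q ^ 3 * (8 * (r * ℓ ^ 2))) ≡⟨ rearrange 64 8 (q ^ 3) r (ℓ ^ 2) ⟩
    512 * r * q ^ 3 * ℓ ^ 2     ∎)
  where
  open ≤-Reasoning
  cubes : ∀ c k q → c * k * q * (c * k * q * (c * k * q * 1)) ≡ c * c * c * (q * (q * (q * 1)) * (k * (k * (k * 1))))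
  cubes = solve-∀

  rearrange : ∀ c d x y z → c * (x * (d * (y * z))) ≡ c * d * y * x * z
  rearrange = solve-∀

  p<4kq : p < 4 * k * q
  p<4kq = 2^-cancel-< (*-cancelˡ-< (n ^ q) _ _ (begin-strict
    n ^ q * 2 ^ p              <⟨ lt ⟩
    N ^ q                      ≤⟨ ^-monoˡ-≤ q N≤ ⟩
    (n * 2 ^ (4 * k)) ^ q      ≡⟨ ^-distribʳ-* q n (2 ^ (4 * k)) ⟩
    n ^ q * (2 ^ (4 * k)) ^ q  ≡⟨ cong (n ^ q *_) (^-*-assoc 2 (4 * k) q) ⟩
    n ^ q * 2 ^ (4 * k * q)    ∎))

-- The lower bound on `n` is strict because the witness in `RamseyBound` needs `2 ^ ℓ < n`; the
-- upper one, with the second clause of `Admissible`, gives `M ≤ 2 ^ (2 * ℓ)`.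
ramsey-number-bound : ∀ {r n} (H : Graph n) → Degenerate r H → Bipartite H → ∀ ℓ k w →
  2 ^ ℓ < n → n ≤ 2 ^ suc ℓ → Admissible r ℓ k w →
  ∃[ N ] (IsRamseyNumber H N × RamseyBound r n N)
ramsey-number-bound {r} {n} H degenerate bipartite ℓ k w 2^ℓ<n n≤ (k³≤ , room , gap₁ , gap₂) =
  let N , ramsey , N≤M = ramsey-number H M 1≤M
        (ramsey-property H degenerate bipartite k w M 1≤n 1≤M
          (power-gap n (4 * k) (2 * ℓ) (2 + k) (r + w) k 1≤n M≤ gap₁)
          (subst (λ z → z * (M ^ r * n ^ w) < M ^ w) (sym (^-*-assoc 2 (2 + k) w))
            (power-gap n (4 * k) (2 * ℓ) ((2 + k) * w) r w 1≤n M≤ gap₂)))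
  in N , ramsey , ramsey-bound {r} {k = k} {ℓ} k³≤ 2^ℓ<n N≤M
  where
  open ≤-Reasoning
  M = n * 2 ^ (4 * k)

  1≤n : 1 ≤ n
  1≤n = ≤-<-trans z≤n 2^ℓ<n

  1≤M : 1 ≤ M
  1≤M = *-mono-≤ 1≤n (m^n>0 2 (4 * k))

  M≤ : M ≤ 2 ^ (2 * ℓ)
  M≤ = begin
    n * 2 ^ (4 * k)          ≤⟨ *-monoˡ-≤ (2 ^ (4 * k)) n≤ ⟩
    2 ^ suc ℓ * 2 ^ (4 * k)  ≡⟨ ^-distribˡ-+-* 2 (suc ℓ) (4 * k) ⟨
    2 ^ (suc ℓ + 4 * k)      ≤⟨ ^-monoʳ-≤ 2 room ⟩
    2 ^ (2 * ℓ)              ∎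

theorem7p4 : (r : ℕ) → 1 ≤ r → ∃[ n₀ ] ((n : ℕ) → n₀ ≤ n → (H : Graph n) → Degenerate r H → Bipartite H → ∃[ N ] (IsRamseyNumber H N × RamseyBound r n N))
-- This threshold gives `2 ^ (r * 4096) < n`, so the search for `ℓ` can start at the value
-- `parameters` requires. It ends by `r * 4096 + n` because `n < 2 ^ n`.
theorem7p4 r 1≤r = suc (2 ^ (r * 4096)) , λ n n-large H degenerate bipartite →
  let ℓ , ℓ-large , 2^ℓ<n , ¬2^sℓ<n = last-before-failure (λ ℓ → 2 ^ ℓ <? n) (r * 4096) n n-large
        (≤⇒≯ (≤-trans (<⇒≤ (n<2^n n)) (^-monoʳ-≤ 2 (m≤n+m n (r * 4096)))))
      k , w , admissible = parameters r ℓ 1≤r ℓ-large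
  in ramsey-number-bound H degenerate bipartite ℓ k w 2^ℓ<n (≮⇒≥ ¬2^sℓ<n) admissible
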